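{- Let $a,b$ be positive integers, $h(j)=aj^2+b$ for $j\ge0$, $h(j)=0$ for $j<0$, and $\alpha=a/b$. Then $$\operatorname{hdepth}(h)=\begin{cases}\lfloor\alpha\rfloor+1,&\alpha\in(0,7),\\ 8,&\alpha\in[7,\tfrac{22}{3}],\\ 7,&\alpha\in(\tfrac{22}{3},8],\\ 6,&\alpha\in(8,11],\\ 5,&\alpha\in(11,\infty).\end{cases}$$
   Context: For a nonzero function $h:\mathbb Z\to\mathbb Z_{\ge 0}$ with $h(j)=0$ for all sufficiently negative $j$, and integers $k\le d$, set $\beta_k^d(h)=\sum_{j\le k}(-1)^{k-j}\binom{d-j}{k-j}h(j)$, and $\operatorname{hdepth}(h)=\max\{d\in\mathbb Z:\ \beta_k^d(h)\ge 0\text{ for all integers }k\le d\}$. -}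

module Defs where

open import Data.Fin.Base using (Fin; toℕ; inject₁; fromℕ)
open import Data.Fin.Properties using (toℕ-inject₁; toℕ-fromℕ)
open import Data.Integer.Base as ℤ
  using (ℤ; +_; -[1+_]; -1ℤ; 0ℤ; ∣_∣; _-_; _*_; _^_; _≤_; _<_)
import Data.Integer.Properties as ℤ
open import Data.Integer.Tactic.RingSolver using (solve-∀)
open import Data.Nat.Base as ℕ using (ℕ; suc; NonZero)
open import Data.Nat.Combinatorics using (_C_)
import Data.Nat.Properties as ℕ
open import Data.Product.Base using (∃; _×_; _,_)
open import Relation.Binary.PropositionalEquality
  using (_≡_; _≢_; refl; cong; cong₂; subst; module ≡-Reasoning)

open import Algebra.Properties.CommutativeMonoid.Sum ℤ.+-0-commutativeMonoid
  using (sum⁺-syntax; sum-init-last; sum-cong-≗)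

record DepthFunction : Set where
  field
    value    : ℤ → ℕ
    lower    : ℤ
    vanishes : ∀ j → j < lower → value j ≡ 0
    nonzero  : ∃ λ j → value j ≢ 0

open DepthFunction public

-- The summand of βₖᵈ(h) at j = k − i.  It is meant for k ≤ d, where
-- d − j ≥ 0 and hence ∣ d - j ∣ is d − j itself.
term : DepthFunction → (d k : ℤ) → ℕ → ℤ
term h d k i = -1ℤ ^ i * + (∣ d - j ∣ C i) * + value h j
  where j = k - + i

-- βₖᵈ(h), an infinite sum over j ≤ k with finite support.  If lower h ≤ k, the
-- indices i ≤ k − lower h are exactly those with lower h ≤ j ≤ k; if
-- k < lower h, every summand is 0.  See β-truncation.
β : DepthFunction → (d k : ℤ) → ℤ
β h d k = ∑[ i ≤ ∣ k - lower h ∣ ] term h d k (toℕ i)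

NonNegativeβ : DepthFunction → ℤ → Set
NonNegativeβ h d = ∀ k → k ≤ d → 0ℤ ≤ β h d k

-- hdepth(h) = d, as a relation: d is the maximum of {e ∈ ℤ : NonNegativeβ h e}.
IsHdepth : DepthFunction → ℤ → Set
IsHdepth h d = NonNegativeβ h d × (∀ e → NonNegativeβ h e → e ≤ d)

quadraticValue : ℕ → ℕ → ℤ → ℕ
quadraticValue a b (+ j)    = a ℕ.* j ℕ.^ 2 ℕ.+ b
quadraticValue a b -[1+ _ ] = 0

quadratic : (a b : ℕ) .{{_ : NonZero b}} → DepthFunction
quadratic a b = record
  { value    = quadraticValue a b
  ; lower    = 0ℤ
  ; vanishes = λ { -[1+ _ ] _ → refl ; (+ _) (ℤ.+<+ ()) }
  ; nonzero  = 0ℤ , λ eq → ℕ.≢-nonZero⁻¹ b (ℕ.m+n≡0⇒n≡0 (a ℕ.* 0) eq)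
  }

IsHdepth-unique : ∀ h {d e} → IsHdepth h d → IsHdepth h e → d ≡ e
IsHdepth-unique h (p , p-max) (q , q-max) = ℤ.≤-antisym (q-max _ p) (p-max _ q)

private
  below-lower : ∀ k m n → ∣ k - m ∣ ℕ.< n → k - + n < m
  below-lower k m n lt = subst (k - + n <_) (k-[k-m] k m)
    (ℤ.+-monoʳ-< k (ℤ.neg-mono-< (ℤ.≤-<-trans (i≤∣i∣ (k - m)) (ℤ.+<+ lt))))
    where
    i≤∣i∣ : ∀ i → i ≤ + ∣ i ∣
    i≤∣i∣ (+ _)    = ℤ.≤-refl
    i≤∣i∣ -[1+ _ ] = ℤ.-≤+

    k-[k-m] : ∀ k m → k - (k - m) ≡ m
    k-[k-m] = solve-∀

term-below-lower : ∀ h d k i → ∣ k - lower h ∣ ℕ.< i → term h d k i ≡ 0ℤ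
term-below-lower h d k i lt = begin
  c * + value h (k - + i)  ≡⟨ cong (λ v → c * + v) (vanishes h _ (below-lower k (lower h) i lt)) ⟩
  c * 0ℤ                   ≡⟨ ℤ.*-zeroʳ c ⟩
  0ℤ                       ∎
  where
  open ≡-Reasoning
  c = -1ℤ ^ i * + (∣ d - (k - + i) ∣ C i)

β-truncation : ∀ h d k n → ∣ k - lower h ∣ ℕ.≤ n →
               ∑[ i ≤ n ] term h d k (toℕ i) ≡ β h d k
β-truncation h d k n N≤n = go (ℕ.≤⇒≤′ N≤n)
  where
  open ≡-Reasoning
  go : ∀ {n} → ∣ k - lower h ∣ ℕ.≤′ n → ∑[ i ≤ n ] term h d k (toℕ i) ≡ β h d k
  go (ℕ.≤′-reflexive refl) = refl
  go (ℕ.≤′-step {n} N≤′n)  = begin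
    ∑[ i ≤ suc n ] t (toℕ i)
      ≡⟨ sum-init-last (λ (i : Fin (suc (suc n))) → t (toℕ i)) ⟩
    ∑[ i ≤ n ] t (toℕ (inject₁ i)) ℤ.+ t (toℕ (fromℕ (suc n)))
      ≡⟨ cong₂ ℤ._+_ (sum-cong-≗ {suc n} (λ i → cong t (toℕ-inject₁ i)))
                     (cong t (toℕ-fromℕ (suc n))) ⟩
    ∑[ i ≤ n ] t (toℕ i) ℤ.+ t (suc n)
      ≡⟨ cong₂ ℤ._+_ (go N≤′n) (term-below-lower h d k (suc n) (ℕ.s≤s (ℕ.≤′⇒≤ N≤′n))) ⟩
    β h d k ℤ.+ 0ℤ
      ≡⟨ ℤ.+-identityʳ _ ⟩
    β h d k ∎
    where t = term h d k

{-# OPTIONS --safe #-}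
module Submission where

-- Write α = a/b.  β is linear in (a , b): β₁ᵈ ≥ 0 says α ≥ d − 1, and for d ≥ 6,
-- β₂ᵈ ≥ 0 says α ≤ (d² − 3d + 4) / (2 (d − 5)).  These are incompatible for d ≥ 9,
-- and for d = 8, 7, 6 the second bound is 22/3, 8, 11.  Conversely, for fixed d ≤ 8,
-- a linear form in (a , b) that is nonnegative at both ends of an interval of
-- values of α is nonnegative on the interval, so checking the finitely many βₖᵈ
-- at the ends (with ∞ = 1/0) shows that the claimed d is attained.

open import Data.Integer using (ℤ; +_; -[1+_]; 1ℤ; 0ℤ; -1ℤ; ∣_∣)
import Data.Integer.Base as ℤ
import Data.Integer.Properties as ℤ
open import Data.Integer.DivMod using ([n/d]*d≤n; n<s[n/ℕd]*d; div-pos-is-/ℕ)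
open import Data.Integer.Tactic.RingSolver using (solve-∀)
open import Data.Fin.Base using (Fin; toℕ; fromℕ<)
open import Data.Fin.Properties using (all?; toℕ-fromℕ<)
open import Data.Nat using (ℕ; zero; suc; NonZero)
import Data.Nat.Base as ℕ
import Data.Nat.Properties as ℕ
open import Data.Nat.Tactic.RingSolver using () renaming (solve-∀ to ℕ-solve-∀)
open import Data.Nat.Combinatorics using (_C_; nC1≡n; nCk+nC[k+1]≡[n+1]C[k+1])
open import Data.Product using (_×_; _,_)
open import Data.Rational using (ℚ; _/_; _<_; _≤_; 0ℚ; floor; toℚᵘ)
import Data.Rational.Base as ℚ
import Data.Rational.Properties as ℚ
open import Data.Rational.Unnormalised.Base as ℚᵘ using (mkℚᵘ; *≤*; *<*)
import Data.Rational.Unnormalised.Properties as ℚᵘ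
open import Relation.Binary.PropositionalEquality
  using (_≡_; refl; sym; trans; cong; cong₂; subst; subst₂; module ≡-Reasoning)
open import Relation.Nullary using (Dec; yes; no; ¬_; contradiction)
open import Relation.Nullary.Decidable using (from-yes; _×-dec_)
open import Defs using (IsHdepth; NonNegativeβ; quadratic; quadraticValue)

open import Algebra.Properties.Semiring.Sum ℤ.+-*-semiring
  using (sum⁺-syntax; sum-cong-≗; ∑-distrib-+; *-distribˡ-sum; sum-replicate-zero)

-- Linearity of βₖᵈ in (a , b), and its vanishing for k < 0.

coefficient : (d k : ℤ) → ℕ → ℤ
coefficient d k i = -1ℤ ℤ.^ i ℤ.* + (∣ d ℤ.- (k ℤ.- + i) ∣ C i)

-- Definitionally β (quadratic a b) d k, but also available for b = 0, which
-- is the end α = ∞.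
quadraticβ : (a b : ℕ) (d k : ℤ) → ℤ
quadraticβ a b d k =
  ∑[ i ≤ ∣ k ℤ.- 0ℤ ∣ ] (coefficient d k (toℕ i) ℤ.* + quadraticValue a b (k ℤ.- + toℕ i))

quadraticValue-linear : ∀ a b j →
  + quadraticValue a b j ≡
  + a ℤ.* + quadraticValue 1 0 j ℤ.+ + b ℤ.* + quadraticValue 0 1 j
quadraticValue-linear a b (+ j) = begin
  + (a ℕ.* j ℕ.^ 2 ℕ.+ b)                         ≡⟨ ℤ.pos-+ (a ℕ.* j ℕ.^ 2) b ⟩
  + (a ℕ.* j ℕ.^ 2) ℤ.+ + b                       ≡⟨ cong (ℤ._+ + b) (ℤ.pos-* a (j ℕ.^ 2)) ⟩
  + a ℤ.* + (j ℕ.^ 2) ℤ.+ + b                     ≡⟨ cong₂ (λ s t → + a ℤ.* + s ℤ.+ t) (sym 1*s+0) (sym (ℤ.*-identityʳ (+ b))) ⟩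
  + a ℤ.* + (1 ℕ.* j ℕ.^ 2 ℕ.+ 0) ℤ.+ + b ℤ.* 1ℤ  ∎
  where
  open ≡-Reasoning
  1*s+0 : 1 ℕ.* j ℕ.^ 2 ℕ.+ 0 ≡ j ℕ.^ 2
  1*s+0 = trans (ℕ.+-identityʳ _) (ℕ.*-identityˡ _)
quadraticValue-linear a b -[1+ j ] = sym (cong₂ ℤ._+_ (ℤ.*-zeroʳ (+ a)) (ℤ.*-zeroʳ (+ b)))

quadraticβ-linear : ∀ a b d k →
  quadraticβ a b d k ≡ + a ℤ.* quadraticβ 1 0 d k ℤ.+ + b ℤ.* quadraticβ 0 1 d k
quadraticβ-linear a b d k = begin
  ∑[ i ≤ n ] (c i ℤ.* v a b i)
    ≡⟨ sum-cong-≗ {suc n} (λ i → trans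
         (cong (c i ℤ.*_) (quadraticValue-linear a b (k ℤ.- + toℕ i)))
         (expand (c i) (+ a) (+ b) (v 1 0 i) (v 0 1 i))) ⟩
  ∑[ i ≤ n ] (+ a ℤ.* s i ℤ.+ + b ℤ.* t i)
    ≡⟨ ∑-distrib-+ {suc n} (λ i → + a ℤ.* s i) (λ i → + b ℤ.* t i) ⟩
  ∑[ i ≤ n ] (+ a ℤ.* s i) ℤ.+ ∑[ i ≤ n ] (+ b ℤ.* t i)
    ≡⟨ cong₂ ℤ._+_ (*-distribˡ-sum {suc n} (+ a) s) (*-distribˡ-sum {suc n} (+ b) t) ⟨
  + a ℤ.* quadraticβ 1 0 d k ℤ.+ + b ℤ.* quadraticβ 0 1 d k ∎
  where
  open ≡-Reasoning
  n = ∣ k ℤ.- 0ℤ ∣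
  c s t : Fin (suc n) → ℤ
  v : ℕ → ℕ → Fin (suc n) → ℤ
  c i = coefficient d k (toℕ i)
  v a b i = + quadraticValue a b (k ℤ.- + toℕ i)
  s i = c i ℤ.* v 1 0 i
  t i = c i ℤ.* v 0 1 i
  expand : ∀ c a b s t → c ℤ.* (a ℤ.* s ℤ.+ b ℤ.* t) ≡ a ℤ.* (c ℤ.* s) ℤ.+ b ℤ.* (c ℤ.* t)
  expand = solve-∀

quadraticβ-negative : ∀ a b d k → quadraticβ a b d -[1+ k ] ≡ 0ℤ
quadraticβ-negative a b d k =
  trans (sum-cong-≗ {suc n} (λ i → vanishes (toℕ i))) (sum-replicate-zero (suc n))
  where
  n = ∣ -[1+ k ] ℤ.- 0ℤ ∣
  vanishes : ∀ i → coefficient d -[1+ k ] i ℤ.* + quadraticValue a b (-[1+ k ] ℤ.- + i) ≡ 0ℤ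
  vanishes zero    = ℤ.*-zeroʳ (coefficient d -[1+ k ] zero)
  vanishes (suc i) = ℤ.*-zeroʳ (coefficient d -[1+ k ] (suc i))

-- Interpolating nonnegativity between two values of α.

-- Indexing by `Fin` makes the condition decidable by evaluation; negative k are left to
-- `quadraticβ-negative`.
Nonneg : (a b d : ℕ) → Set
Nonneg a b d = ∀ (k : Fin (suc d)) → 0ℤ ℤ.≤ quadraticβ a b (+ d) (+ toℕ k)

nonneg? : ∀ a b d → Dec (Nonneg a b d)
nonneg? a b d = all? λ k → 0ℤ ℤ.≤? quadraticβ a b (+ d) (+ toℕ k)

-- The ends are α = l/m and α = n/p; the first component says l/m < n/p.
NonnegAtEnds : (l m n p d : ℕ) → Set
NonnegAtEnds l m n p d =
  0ℤ ℤ.< + n ℤ.* + m ℤ.- + l ℤ.* + p × Nonneg l m d × Nonneg n p d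

nonnegAtEnds? : ∀ l m n p d → Dec (NonnegAtEnds l m n p d)
nonnegAtEnds? l m n p d =
  (0ℤ ℤ.<? + n ℤ.* + m ℤ.- + l ℤ.* + p) ×-dec (nonneg? l m d ×-dec nonneg? n p d)

0≤pos : ∀ {n} → 0ℤ ℤ.≤ + n
0≤pos = ℤ.+≤+ ℕ.z≤n

0≤+ : ∀ {i j} → 0ℤ ℤ.≤ i → 0ℤ ℤ.≤ j → 0ℤ ℤ.≤ i ℤ.+ j
0≤+ = ℤ.+-mono-≤

0≤* : ∀ {i j} → 0ℤ ℤ.≤ i → 0ℤ ℤ.≤ j → 0ℤ ℤ.≤ i ℤ.* j
0≤* {i} {+ _} 0≤i _ = ℤ.*-monoʳ-≤-nonNeg _ 0≤i

-- With det = nm - lp, det · (a , b) = (nb - ap) · (l , m) + (am - lb) · (n , p). Both weights are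
-- nonnegative for α between the ends, so linearity makes det · βₖᵈ nonnegative, and det > 0
-- cancels. No division occurs, so `p` may be 0.
β-nonNeg : ∀ {a b} .{{_ : NonZero b}} (l m n p d : ℕ) → NonnegAtEnds l m n p d →
  + l ℤ.* + b ℤ.≤ + a ℤ.* + m → + a ℤ.* + p ℤ.≤ + n ℤ.* + b →
  NonNegativeβ (quadratic a b) (+ d)
β-nonNeg {a} {b} l m n p d _ _ _ -[1+ k ] _ =
  ℤ.≤-reflexive (sym (quadraticβ-negative a b (+ d) k))
β-nonNeg {a} {b} l m n p d (det>0 , at-l/m , at-n/p) l/m≤a/b a/b≤n/p (+ k) (ℤ.+≤+ k≤d) =
  ℤ.*-cancelˡ-≤-pos 0ℤ (quadraticβ a b (+ d) (+ k)) det {{ℤ.positive det>0}} (begin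
    det ℤ.* 0ℤ
      ≡⟨ ℤ.*-zeroʳ det ⟩
    0ℤ
      ≤⟨ 0≤+ (0≤* (ℤ.i≤j⇒0≤j-i a/b≤n/p) (linear l m at-l/m))
             (0≤* (ℤ.i≤j⇒0≤j-i l/m≤a/b) (linear n p at-n/p)) ⟩
    (+ n ℤ.* + b ℤ.- + a ℤ.* + p) ℤ.* (+ l ℤ.* P ℤ.+ + m ℤ.* Q) ℤ.+
    (+ a ℤ.* + m ℤ.- + l ℤ.* + b) ℤ.* (+ n ℤ.* P ℤ.+ + p ℤ.* Q)
      ≡⟨ weighted-ends (+ a) (+ b) (+ l) (+ m) (+ n) (+ p) P Q ⟩
    det ℤ.* (+ a ℤ.* P ℤ.+ + b ℤ.* Q)
      ≡⟨ cong (det ℤ.*_) (sym (quadraticβ-linear a b (+ d) (+ k))) ⟩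
    det ℤ.* quadraticβ a b (+ d) (+ k) ∎)
  where
  open ℤ.≤-Reasoning
  det = + n ℤ.* + m ℤ.- + l ℤ.* + p
  P = quadraticβ 1 0 (+ d) (+ k)
  Q = quadraticβ 0 1 (+ d) (+ k)
  linear : ∀ x y → Nonneg x y d → 0ℤ ℤ.≤ + x ℤ.* P ℤ.+ + y ℤ.* Q
  linear x y h = subst (0ℤ ℤ.≤_)
    (trans (cong (λ k → quadraticβ x y (+ d) (+ k)) (toℕ-fromℕ< (ℕ.s≤s k≤d)))
           (quadraticβ-linear x y (+ d) (+ k)))
    (h (fromℕ< (ℕ.s≤s k≤d)))
  weighted-ends : ∀ a b l m n p P Q →
    (n ℤ.* b ℤ.- a ℤ.* p) ℤ.* (l ℤ.* P ℤ.+ m ℤ.* Q) ℤ.+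
    (a ℤ.* m ℤ.- l ℤ.* b) ℤ.* (n ℤ.* P ℤ.+ p ℤ.* Q) ≡
    (n ℤ.* m ℤ.- l ℤ.* p) ℤ.* (a ℤ.* P ℤ.+ b ℤ.* Q)
  weighted-ends = solve-∀

-- β₁ᵈ and β₂ᵈ in closed form, and the upper bounds on d.

quadraticβ₁ : ∀ a b m → quadraticβ a b (+ suc m) 1ℤ ≡ + a ℤ.- + m ℤ.* + b
quadraticβ₁ a b m = trans (quadraticβ-linear a b (+ suc m) 1ℤ)
  (lemma ((suc m ℕ.+ 0) C 1) (trans (nC1≡n (suc m ℕ.+ 0)) (ℕ.+-identityʳ (suc m))))
  where
  -- The left side is the sum over i = 0, 1 unfolded at (1 , 0) and at (0 , 1); `c` stands for the
  -- binomial coefficient, evaluated by `nC1≡n`.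
  lemma : ∀ c → c ≡ suc m →
    + a ℤ.* (1ℤ ℤ.+ (-1ℤ ℤ.* + c ℤ.* 0ℤ ℤ.+ 0ℤ)) ℤ.+ + b ℤ.* (1ℤ ℤ.+ (-1ℤ ℤ.* + c ℤ.* 1ℤ ℤ.+ 0ℤ)) ≡
    + a ℤ.- + m ℤ.* + b
  lemma _ refl = expand (+ a) (+ b) (+ m)
    where
    expand : ∀ a b m →
      a ℤ.* (1ℤ ℤ.+ (-1ℤ ℤ.* (1ℤ ℤ.+ m) ℤ.* 0ℤ ℤ.+ 0ℤ)) ℤ.+
      b ℤ.* (1ℤ ℤ.+ (-1ℤ ℤ.* (1ℤ ℤ.+ m) ℤ.* 1ℤ ℤ.+ 0ℤ)) ≡ a ℤ.- m ℤ.* b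
    expand = solve-∀

-- Doubling keeps the formula free of division; the induction is Pascal's rule.
2*nC2 : ∀ n → 2 ℕ.* (suc n C 2) ≡ suc n ℕ.* n
2*nC2 zero    = refl
2*nC2 (suc n) = begin
  2 ℕ.* (suc (suc n) C 2)                ≡⟨ cong (2 ℕ.*_) (nCk+nC[k+1]≡[n+1]C[k+1] (suc n) 1) ⟨
  2 ℕ.* (suc n C 1 ℕ.+ suc n C 2)        ≡⟨ ℕ.*-distribˡ-+ 2 (suc n C 1) (suc n C 2) ⟩
  2 ℕ.* (suc n C 1) ℕ.+ 2 ℕ.* (suc n C 2)  ≡⟨ cong₂ (λ s t → 2 ℕ.* s ℕ.+ t) (nC1≡n (suc n)) (2*nC2 n) ⟩
  2 ℕ.* suc n ℕ.+ suc n ℕ.* n            ≡⟨ expand n ⟩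
  suc (suc n) ℕ.* suc n                  ∎
  where
  open ≡-Reasoning
  expand : ∀ n → 2 ℕ.* suc n ℕ.+ suc n ℕ.* n ≡ suc (suc n) ℕ.* suc n
  expand = ℕ-solve-∀

-- β₂ᵈ = h(2) - (d - 1) h(1) + C(d , 2) h(0), doubled to clear the binomial. Writing d = 5 + r gives
-- `a` the coefficient -2r, so for r > 0 this bounds α from above.
quadraticβ₂ : ∀ a b r → + 2 ℤ.* quadraticβ a b (+ (5 ℕ.+ r)) (+ 2) ≡
  (+ r ℤ.* + r ℤ.+ + 7 ℤ.* + r ℤ.+ + 14) ℤ.* + b ℤ.- + 2 ℤ.* + r ℤ.* + a
quadraticβ₂ a b r = trans (cong (+ 2 ℤ.*_) (quadraticβ-linear a b (+ (5 ℕ.+ r)) (+ 2)))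
  (lemma ((4 ℕ.+ r) C 1) (nC1≡n (4 ℕ.+ r)) ((5 ℕ.+ r ℕ.+ 0) C 2)
    (trans (2*nC2 (4 ℕ.+ r ℕ.+ 0)) (cong (λ n → suc n ℕ.* n) (ℕ.+-identityʳ (4 ℕ.+ r)))))
  where
  lemma : ∀ c → c ≡ 4 ℕ.+ r → ∀ e → 2 ℕ.* e ≡ (5 ℕ.+ r) ℕ.* (4 ℕ.+ r) →
    + 2 ℤ.* (+ a ℤ.* (+ 4 ℤ.+ (-1ℤ ℤ.* + c ℤ.* 1ℤ ℤ.+ (1ℤ ℤ.* + e ℤ.* 0ℤ ℤ.+ 0ℤ))) ℤ.+
             + b ℤ.* (1ℤ ℤ.+ (-1ℤ ℤ.* + c ℤ.* 1ℤ ℤ.+ (1ℤ ℤ.* + e ℤ.* 1ℤ ℤ.+ 0ℤ)))) ≡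
    (+ r ℤ.* + r ℤ.+ + 7 ℤ.* + r ℤ.+ + 14) ℤ.* + b ℤ.- + 2 ℤ.* + r ℤ.* + a
  lemma _ refl e 2e≡ = trans (isolate (+ a) (+ b) (+ r) (+ e))
    (trans (cong (λ x → + 2 ℤ.* + a ℤ.* (ℤ.- + r) ℤ.+ + b ℤ.* (x ℤ.- + 2 ℤ.* (+ 3 ℤ.+ + r)))
                 (trans (sym (ℤ.pos-* 2 e)) (trans (cong +_ 2e≡) (ℤ.pos-* (5 ℕ.+ r) (4 ℕ.+ r)))))
           (expand (+ a) (+ b) (+ r)))
    where
    isolate : ∀ a b r e →
      + 2 ℤ.* (a ℤ.* (+ 4 ℤ.+ (-1ℤ ℤ.* (+ 4 ℤ.+ r) ℤ.* 1ℤ ℤ.+ (1ℤ ℤ.* e ℤ.* 0ℤ ℤ.+ 0ℤ))) ℤ.+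
               b ℤ.* (1ℤ ℤ.+ (-1ℤ ℤ.* (+ 4 ℤ.+ r) ℤ.* 1ℤ ℤ.+ (1ℤ ℤ.* e ℤ.* 1ℤ ℤ.+ 0ℤ)))) ≡
      + 2 ℤ.* a ℤ.* (ℤ.- r) ℤ.+ b ℤ.* (+ 2 ℤ.* e ℤ.- + 2 ℤ.* (+ 3 ℤ.+ r))
    isolate = solve-∀
    expand : ∀ a b r →
      + 2 ℤ.* a ℤ.* (ℤ.- r) ℤ.+ b ℤ.* ((+ 5 ℤ.+ r) ℤ.* (+ 4 ℤ.+ r) ℤ.- + 2 ℤ.* (+ 3 ℤ.+ r)) ≡
      (r ℤ.* r ℤ.+ + 7 ℤ.* r ℤ.+ + 14) ℤ.* b ℤ.- + 2 ℤ.* r ℤ.* a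
    expand = solve-∀

nonNegativeβ⇒β₁-bound : ∀ a b .{{_ : NonZero b}} m →
  NonNegativeβ (quadratic a b) (+ suc m) → + m ℤ.* + b ℤ.≤ + a
nonNegativeβ⇒β₁-bound a b m h = ℤ.0≤i-j⇒j≤i
  (subst (0ℤ ℤ.≤_) (quadraticβ₁ a b m) (h 1ℤ (ℤ.+≤+ (ℕ.s≤s ℕ.z≤n))))

nonNegativeβ⇒β₂-bound : ∀ a b .{{_ : NonZero b}} r →
  NonNegativeβ (quadratic a b) (+ (5 ℕ.+ r)) →
  + 2 ℤ.* + r ℤ.* + a ℤ.≤ (+ r ℤ.* + r ℤ.+ + 7 ℤ.* + r ℤ.+ + 14) ℤ.* + b
nonNegativeβ⇒β₂-bound a b r h = ℤ.0≤i-j⇒j≤i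
  (subst (0ℤ ℤ.≤_) (quadraticβ₂ a b r)
    (0≤* {+ 2} {quadraticβ a b (+ (5 ℕ.+ r)) (+ 2)} 0≤pos (h (+ 2) (ℤ.+≤+ (ℕ.s≤s (ℕ.s≤s ℕ.z≤n))))))

-- Adding 2(d - 5) β₁ᵈ to 2 β₂ᵈ eliminates `a` and leaves a negative multiple of `b`.
¬nonNegativeβ-9+ : ∀ a b .{{_ : NonZero b}} s → ¬ NonNegativeβ (quadratic a b) (+ (9 ℕ.+ s))
¬nonNegativeβ-9+ a b@(suc _) s h = ℤ.<⇒≱ 6b<0
  (subst (0ℤ ℤ.≤_) (combine (+ a) (+ b) (+ s))
    (0≤+ (0≤+ (ℤ.i≤j⇒0≤j-i (nonNegativeβ⇒β₂-bound a b (4 ℕ.+ s) h))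
              (0≤* 0≤2r (ℤ.i≤j⇒0≤j-i (nonNegativeβ⇒β₁-bound a b (8 ℕ.+ s) h))))
         -- Adding (s² + 9s) b brings the total to -6b, which is visibly negative because `b` is a
         -- successor.
         (0≤* {j = + b} 0≤s²+9s 0≤pos)))
  where
  6b<0 : ℤ.- (+ 6 ℤ.* + b) ℤ.< 0ℤ
  6b<0 = ℤ.-<+
  0≤2r : 0ℤ ℤ.≤ + 2 ℤ.* + (4 ℕ.+ s)
  0≤2r = 0≤pos
  0≤s²+9s : 0ℤ ℤ.≤ + s ℤ.* + s ℤ.+ + 9 ℤ.* + s
  0≤s²+9s = 0≤+ (0≤* {+ s} {+ s} 0≤pos 0≤pos) (0≤* {+ 9} {+ s} 0≤pos 0≤pos)
  -- 2β₂ + 2(4 + s)β₁ = −(s² + 9s + 6)b at d = 9 + s.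
  combine : ∀ a b s →
    (((+ 4 ℤ.+ s) ℤ.* (+ 4 ℤ.+ s) ℤ.+ + 7 ℤ.* (+ 4 ℤ.+ s) ℤ.+ + 14) ℤ.* b ℤ.- + 2 ℤ.* (+ 4 ℤ.+ s) ℤ.* a) ℤ.+
    + 2 ℤ.* (+ 4 ℤ.+ s) ℤ.* (a ℤ.- (+ 8 ℤ.+ s) ℤ.* b) ℤ.+
    (s ℤ.* s ℤ.+ + 9 ℤ.* s) ℤ.* b ≡ ℤ.- (+ 6 ℤ.* b)
  combine = solve-∀

nonNegativeβ⇒≤8 : ∀ a b .{{_ : NonZero b}} {e} → NonNegativeβ (quadratic a b) e → e ℤ.≤ + 8
nonNegativeβ⇒≤8 a b { -[1+ _ ]} h = ℤ.-≤+
nonNegativeβ⇒≤8 a b {+ n} h with n ℕ.≤? 8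
... | yes n≤8 = ℤ.+≤+ n≤8
... | no  n≰8 with ℕ.m≤n⇒∃[o]m+o≡n (ℕ.≰⇒> n≰8)
...   | s , refl = contradiction h (¬nonNegativeβ-9+ a b s)

-- The β₂ threshold for α at d = 5 + r is (r² + 7r + 14) / 2r; `n` over `m` is this fraction with
-- the common factor `c` cancelled.
¬nonNegativeβ-above : ∀ a b .{{_ : NonZero b}} r c n m .{{_ : NonZero c}} →
  + r ℤ.* + r ℤ.+ + 7 ℤ.* + r ℤ.+ + 14 ≡ + c ℤ.* n → + 2 ℤ.* + r ≡ + c ℤ.* m →
  n ℤ.* + b ℤ.< + a ℤ.* m → ¬ NonNegativeβ (quadratic a b) (+ (5 ℕ.+ r))
¬nonNegativeβ-above a b r c@(suc _) n m cn≡ cm≡ n/m<a/b h = ℤ.<⇒≱ (begin-strict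
  (+ r ℤ.* + r ℤ.+ + 7 ℤ.* + r ℤ.+ + 14) ℤ.* + b  ≡⟨ cong (ℤ._* + b) cn≡ ⟩
  + c ℤ.* n ℤ.* + b                               ≡⟨ ℤ.*-assoc (+ c) n (+ b) ⟩
  + c ℤ.* (n ℤ.* + b)                             <⟨ ℤ.*-monoˡ-<-pos (+ c) n/m<a/b ⟩
  + c ℤ.* (+ a ℤ.* m)                             ≡⟨ rearrange (+ c) (+ a) m ⟩
  + c ℤ.* m ℤ.* + a                               ≡⟨ cong (ℤ._* + a) cm≡ ⟨
  + 2 ℤ.* + r ℤ.* + a                             ∎)
  (nonNegativeβ⇒β₂-bound a b r h)
  where
  open ℤ.≤-Reasoning
  rearrange : ∀ c a m → c ℤ.* (a ℤ.* m) ≡ c ℤ.* m ℤ.* a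
  rearrange = solve-∀

-- Excluding one value of d does not by itself exclude larger ones, so the bound descends from 8 one
-- step at a time.
≤suc∧¬suc⇒≤ : ∀ {a b e} .{{_ : NonZero b}} n →
  NonNegativeβ (quadratic a b) e → ¬ NonNegativeβ (quadratic a b) (+ suc n) →
  e ℤ.≤ + suc n → e ℤ.≤ + n
≤suc∧¬suc⇒≤ n h ¬h e≤1+n =
  ℤ.i<j⇒i≤pred[j] (ℤ.≤∧≢⇒< e≤1+n λ { refl → ¬h h })

-- From rational inequalities and the floor to integer inequalities.

-- In ℚ, `/` reduces to lowest terms; in ℚᵘ it keeps numerator and denominator, so that the order
-- there unfolds to cross multiplication.
toℚᵘ-/ : ∀ i n .{{_ : NonZero n}} → toℚᵘ (i / n) ℚᵘ.≃ i ℚᵘ./ n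
toℚᵘ-/ i (suc n) = ℚ.toℚᵘ-fromℚᵘ (mkℚᵘ i n)

/-≤-/⇒*-≤-* : ∀ i m j n .{{_ : NonZero m}} .{{_ : NonZero n}} →
  i / m ≤ j / n → i ℤ.* + n ℤ.≤ j ℤ.* + m
/-≤-/⇒*-≤-* i m@(suc _) j n@(suc _) i/m≤j/n = ℚᵘ.drop-*≤*
  (ℚᵘ.≤-respˡ-≃ (toℚᵘ-/ i m) (ℚᵘ.≤-respʳ-≃ (toℚᵘ-/ j n) (ℚ.toℚᵘ-mono-≤ i/m≤j/n)))

/-<-/⇒*-<-* : ∀ i m j n .{{_ : NonZero m}} .{{_ : NonZero n}} →
  i / m < j / n → i ℤ.* + n ℤ.< j ℤ.* + m
/-<-/⇒*-<-* i m@(suc _) j n@(suc _) i/m<j/n = ℚᵘ.drop-*<*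
  (ℚᵘ.<-respˡ-≃ (toℚᵘ-/ i m) (ℚᵘ.<-respʳ-≃ (toℚᵘ-/ j n) (ℚ.toℚᵘ-mono-< i/m<j/n)))

-- `mkℚᵘ` stores the denominator minus one, so the 0 makes the floor a fraction over 1.
floor-≤ : ∀ p → mkℚᵘ (floor p) 0 ℚᵘ.≤ toℚᵘ p
floor-≤ p@record{} = *≤* (subst (floor p ℤ.* ℚ.↧ p ℤ.≤_) (sym (ℤ.*-identityʳ (ℚ.↥ p)))
  ([n/d]*d≤n (ℚ.↥ p) (ℚ.↧ p)))

<-suc-floor : ∀ p → toℚᵘ p ℚᵘ.< mkℚᵘ (ℤ.suc (floor p)) 0
<-suc-floor p@record{} = *<* (subst₂ ℤ._<_ (sym (ℤ.*-identityʳ (ℚ.↥ p)))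
  (cong (λ q → ℤ.suc q ℤ.* ℚ.↧ p) (sym (div-pos-is-/ℕ (ℚ.↥ p) (ℚ.↧ₙ p))))
  (n<s[n/ℕd]*d (ℚ.↥ p) (ℚ.↧ₙ p)))

floor-/-*-≤ : ∀ i n .{{_ : NonZero n}} → floor (i / n) ℤ.* + n ℤ.≤ i ℤ.* 1ℤ
floor-/-*-≤ i n@(suc _) = ℚᵘ.drop-*≤* (ℚᵘ.≤-respʳ-≃ (toℚᵘ-/ i n) (floor-≤ (i / n)))

<-suc-floor-/-* : ∀ i n .{{_ : NonZero n}} → i ℤ.* 1ℤ ℤ.< ℤ.suc (floor (i / n)) ℤ.* + n
<-suc-floor-/-* i n@(suc _) = ℚᵘ.drop-*<* (ℚᵘ.<-respˡ-≃ (toℚᵘ-/ i n) (<-suc-floor (i / n)))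

-- The five ranges of α.

-- Here `q` plays the floor of α. The value d = q + 1 is attained by interpolating between q and q +
-- 1, and it is maximal because β₁ gives d - 1 ≤ α < q + 1.
isHdepth-below-7 : ∀ a b .{{_ : NonZero b}} q →
  q ℤ.* + b ℤ.≤ + a ℤ.* 1ℤ → + a ℤ.* 1ℤ ℤ.< ℤ.suc q ℤ.* + b → + a ℤ.* 1ℤ ℤ.< + 7 ℤ.* + b →
  IsHdepth (quadratic a b) (q ℤ.+ 1ℤ)
isHdepth-below-7 a b -[1+ n ] _ a<[1+q]b _ = contradiction 0<1+q (ℤ.≤⇒≯ (suc≤0 n))
  where
  0<1+q : 0ℤ ℤ.< ℤ.suc -[1+ n ]
  0<1+q = ℤ.*-cancelʳ-<-nonNeg (+ b)
    (ℤ.≤-<-trans (0≤* {+ a} {1ℤ} 0≤pos 0≤pos) a<[1+q]b)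
  suc≤0 : ∀ n → ℤ.suc -[1+ n ] ℤ.≤ 0ℤ
  suc≤0 zero    = ℤ.≤-refl
  suc≤0 (suc _) = ℤ.-≤+
isHdepth-below-7 a b (+ n) nb≤a a<[1+n]b a<7b =
  β-nonNeg n 1 (suc n) 1 (n ℕ.+ 1) atEnds nb≤a (ℤ.<⇒≤ a<[1+n]b) , maximal
  where
  n<7 : n ℕ.< 7
  n<7 = ℤ.drop‿+<+ (ℤ.*-cancelʳ-<-nonNeg (+ b) (ℤ.≤-<-trans nb≤a a<7b))
  atEnds : NonnegAtEnds n 1 (suc n) 1 (n ℕ.+ 1)
  -- α < 7 leaves only n = 0, ..., 6, which are decided by evaluation.
  atEnds = subst (λ n → NonnegAtEnds n 1 (suc n) 1 (n ℕ.+ 1)) (toℕ-fromℕ< n<7)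
    (from-yes (all? {n = 7} λ q → nonnegAtEnds? (toℕ q) 1 (suc (toℕ q)) 1 (toℕ q ℕ.+ 1))
      (fromℕ< n<7))
  maximal : ∀ e → NonNegativeβ (quadratic a b) e → e ℤ.≤ + (n ℕ.+ 1)
  maximal -[1+ _ ]  _ = ℤ.-≤+
  maximal (+ zero)  _ = 0≤pos
  maximal (+ suc m) h = ℤ.+≤+ (subst (suc m ℕ.≤_) (ℕ.+-comm 1 n)
    (ℤ.drop‿+<+ (ℤ.*-cancelʳ-<-nonNeg (+ b) (ℤ.≤-<-trans
      (ℤ.≤-trans (nonNegativeβ⇒β₁-bound a b m h) (ℤ.≤-reflexive (sym (ℤ.*-identityʳ (+ a)))))
      a<[1+n]b))))

theorem3p10 : ∀ (a b : ℕ) .{{_ : NonZero a}} .{{_ : NonZero b}} →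
    let h = quadratic a b
        α = + a / b
    in (0ℚ < α → α < + 7 / 1 → IsHdepth h (floor α ℤ.+ 1ℤ))
     × (+ 7 / 1 ≤ α → α ≤ + 22 / 3 → IsHdepth h (+ 8))
     × (+ 22 / 3 < α → α ≤ + 8 / 1 → IsHdepth h (+ 7))
     × (+ 8 / 1 < α → α ≤ + 11 / 1 → IsHdepth h (+ 6))
     × (+ 11 / 1 < α → IsHdepth h (+ 5))
theorem3p10 a b =
  (λ _ α<7 →
    isHdepth-below-7 a b (floor α) (floor-/-*-≤ (+ a) b) (<-suc-floor-/-* (+ a) b)
      (/-<-/⇒*-<-* (+ a) b (+ 7) 1 α<7)) ,
  (λ 7≤α α≤22/3 →
    β-nonNeg 7 1 22 3 8 (from-yes (nonnegAtEnds? 7 1 22 3 8))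
      (/-≤-/⇒*-≤-* (+ 7) 1 (+ a) b 7≤α) (/-≤-/⇒*-≤-* (+ a) b (+ 22) 3 α≤22/3) ,
    λ _ → nonNegativeβ⇒≤8 a b) ,
  (λ 22/3<α α≤8 →
    β-nonNeg 22 3 8 1 7 (from-yes (nonnegAtEnds? 22 3 8 1 7))
      (ℤ.<⇒≤ (/-<-/⇒*-<-* (+ 22) 3 (+ a) b 22/3<α)) (/-≤-/⇒*-≤-* (+ a) b (+ 8) 1 α≤8) ,
    λ _ → ≤7 22/3<α) ,
  (λ 8<α α≤11 →
    β-nonNeg 8 1 11 1 6 (from-yes (nonnegAtEnds? 8 1 11 1 6))
      (ℤ.<⇒≤ (/-<-/⇒*-<-* (+ 8) 1 (+ a) b 8<α)) (/-≤-/⇒*-≤-* (+ a) b (+ 11) 1 α≤11) ,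
    λ _ → ≤6 8<α) ,
  (λ 11<α →
    -- At d = 5 the coefficient of `a` in β₂ᵈ is zero, so α may grow without bound: the upper end is
    -- 1/0, and its inequality reads a · 0 ≤ 1 · b.
    β-nonNeg 11 1 1 0 5 (from-yes (nonnegAtEnds? 11 1 1 0 5))
      (ℤ.<⇒≤ (/-<-/⇒*-<-* (+ 11) 1 (+ a) b 11<α))
      (subst (ℤ._≤ 1ℤ ℤ.* + b) (sym (ℤ.*-zeroʳ (+ a))) (0≤* {1ℤ} {+ b} 0≤pos 0≤pos)) ,
    λ _ → ≤5 11<α)
  where
  α = + a / b
  ≤7 : + 22 / 3 < α → ∀ {e} → NonNegativeβ (quadratic a b) e → e ℤ.≤ + 7
  ≤7 22/3<α h = ≤suc∧¬suc⇒≤ 7 h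
    -- At d = 8 the threshold is 44/6 = 22/3; likewise 32/4 = 8 at d = 7 and 22/2 = 11 at d = 6
    -- below.
    (¬nonNegativeβ-above a b 3 2 (+ 22) (+ 3) refl refl
      (/-<-/⇒*-<-* (+ 22) 3 (+ a) b 22/3<α)) (nonNegativeβ⇒≤8 a b h)
  ≤6 : + 8 / 1 < α → ∀ {e} → NonNegativeβ (quadratic a b) e → e ℤ.≤ + 6
  ≤6 8<α h = ≤suc∧¬suc⇒≤ 6 h
    (¬nonNegativeβ-above a b 2 4 (+ 8) (+ 1) refl refl
      (/-<-/⇒*-<-* (+ 8) 1 (+ a) b 8<α))
    (≤7 (ℚ.<-trans (from-yes (+ 22 / 3 ℚ.<? + 8 / 1)) 8<α) h)
  ≤5 : + 11 / 1 < α → ∀ {e} → NonNegativeβ (quadratic a b) e → e ℤ.≤ + 5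
  ≤5 11<α h = ≤suc∧¬suc⇒≤ 5 h
    (¬nonNegativeβ-above a b 1 2 (+ 11) (+ 1) refl refl
      (/-<-/⇒*-<-* (+ 11) 1 (+ a) b 11<α))
    (≤6 (ℚ.<-trans (from-yes (+ 8 / 1 ℚ.<? + 11 / 1)) 11<α) h)
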